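{- For every theory $\Gamma$ and every sentence $\varphi$ of $\mathcal{L}_{4.5}^+$: if $\Gamma\models\varphi$, then $\Gamma\vdash\varphi$.
   Context: Syntax of $\mathcal{L}_{4.5}^+$. Fix a set $P$ of nouns and a set $R$ of verbs. Terms: every noun is a term; if $x$ is a term and $r\in R$ then $(r\ \mathsf{all}\ x)$ and $\overline{x}$ are terms. Sentences: $[x_1,\dots,x_n]$ and $\langle x_1,\dots,x_n\rangle$ for all $n\ge1$ and terms $x_1,\dots,x_n$. A theory is a set of sentences. Semantics. A model $\mathcal{M}$ is a set $M$ (possibly empty) with $[\![p]\!]\subseteq M$ for $p\in P$ and $[\![r]\!]\subseteq M\times M$ for $r\in R$; $[\![r\ \mathsf{all}\ x]\!]=\{m\in M: m\,[\![r]\!]\,n\text{ for all }n\in[\![x]\!]\}$; $[\![\overline{x}]\!]=M\setminus[\![x]\!]$. $\mathcal{M}\models[x_1,\dots,x_n]$ iff $\bigcap_{i=1}^n[\![x_i]\!]=\emptyset$; $\mathcal{M}\models\langle x_1,\dots,x_n\rangle$ iff $\bigcap_{i=1}^n[\![x_i]\!]\neq\emptyset$. $\Gamma\models\varphi$ means every model of $\Gamma$ satisfies $\varphi$. Proof rules. $\Gamma\vdash\varphi$ means there is a finite derivation of $\varphi$ with non-withdrawn assumptions in $\Gamma$ using: (axiom) infer $[x,\overline{x}]$ from no premises; (res) from $[x,y_1,\dots,y_n]$ and $[\overline{x},z_1,\dots,z_m]$ infer $[y_1,\dots,y_n,z_1,\dots,z_m]$; (rel) from $[\overline{x_1},\dots,\overline{x_{n-1}},x_n]$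 infer $[(r\ \mathsf{all}\ x_1),\dots,(r\ \mathsf{all}\ x_{n-1}),\overline{(r\ \mathsf{all}\ x_n)}]$; (structural) from $[x_1,\dots,x_m]$ infer $[y_1,\dots,y_n]$, provided each $x_i$ is identical to some $y_j$; (efq) from $\langle y_1,\dots,y_m\rangle$ and $[y_1,\dots,y_m]$ infer $[x_1,\dots,x_n]$; (raa) given derivations of $\langle y_1,\dots,y_m\rangle$ and of $[y_1,\dots,y_m]$, both from $\Gamma\cup\{[x_1,\dots,x_n]\}$, conclude $\langle x_1,\dots,x_n\rangle$ from $\Gamma$ (withdrawing the assumption $[x_1,\dots,x_n]$). In (res) $n$ or $m$ may be $0$ as long as the conclusion is a nonempty list; in (rel) $n\ge1$. -}

module Defs where

open import Level using (Level; suc)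
open import Data.List.Base using (List; _∷_; _++_; map)
open import Data.List.NonEmpty.Base using (List⁺; _∷_; toList; _∷ʳ_)
open import Data.List.NonEmpty.Relation.Unary.All using (All)
open import Data.List.Relation.Binary.Subset.Propositional using (_⊆_)
open import Relation.Binary.Core using (Rel)
open import Relation.Binary.PropositionalEquality.Core using (_≡_)
open import Relation.Unary using (Pred; _∈_; _∪_; ｛_｝; ∁; Empty; Satisfiable)

private
  variable
    ℓ : Level
    P R : Set ℓ

infix  9 _ᶜ
infixr 8 _all_
infix  4 _⊨ᴹ_ _⊨_ _⊢_

data Term {ℓ} (P R : Set ℓ) : Set ℓ where
  noun  : P → Term P R
  _all_ : R → Term P R → Term P R
  _ᶜ    : Term P R → Term P R

data Sentence {ℓ} (P R : Set ℓ) : Set ℓ where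
  [_] : List⁺ (Term P R) → Sentence P R
  ⟨_⟩ : List⁺ (Term P R) → Sentence P R

Theory : ∀ {ℓ} (P R : Set ℓ) → Set (suc ℓ)
Theory {ℓ} P R = Pred (Sentence P R) ℓ

record Model {ℓ} (P R : Set ℓ) : Set (suc ℓ) where
  field
    Carrier : Set ℓ
    nounᴹ   : P → Pred Carrier ℓ
    verbᴹ   : R → Rel Carrier ℓ

  ⟦_⟧ : Term P R → Pred Carrier ℓ
  ⟦ noun p ⟧  = nounᴹ p
  ⟦ r all x ⟧ = λ m → ∀ n → n ∈ ⟦ x ⟧ → verbᴹ r m n
  ⟦ x ᶜ ⟧     = ∁ ⟦ x ⟧

  ⋂⟦_⟧ : List⁺ (Term P R) → Pred Carrier ℓ
  ⋂⟦ xs ⟧ m = All (λ x → m ∈ ⟦ x ⟧) xs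

_⊨ᴹ_ : {P R : Set ℓ} → Model P R → Sentence P R → Set ℓ
M ⊨ᴹ [ xs ] = Empty (Model.⋂⟦_⟧ M xs)
M ⊨ᴹ ⟨ xs ⟩ = Satisfiable (Model.⋂⟦_⟧ M xs)

_⊨_ : {P R : Set ℓ} → Theory P R → Sentence P R → Set (suc ℓ)
_⊨_ {P = P} {R = R} Γ φ =
  (M : Model P R) → (∀ ψ → ψ ∈ Γ → M ⊨ᴹ ψ) → M ⊨ᴹ φ

-- Natural deduction in sequent style: Γ ⊢ φ is the type of finite
-- derivations of φ whose non-withdrawn assumptions all lie in Γ, so
-- withdrawing an assumption in raa is a change of Γ between premises and
-- conclusion.
data _⊢_ {ℓ} {P R : Set ℓ} (Γ : Theory P R) : Sentence P R → Set ℓ where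
  assumption : ∀ {φ} → φ ∈ Γ → Γ ⊢ φ

  axiom : ∀ x → Γ ⊢ [ x ∷ x ᶜ ∷ List.[] ]

  -- The equation makes the conclusion [ ys ++ zs ] with ys ++ zs nonempty.
  res : ∀ {x ys zs} ws → toList ws ≡ ys ++ zs →
        Γ ⊢ [ x ∷ ys ] → Γ ⊢ [ x ᶜ ∷ zs ] → Γ ⊢ [ ws ]

  rel : ∀ r xs x →
        Γ ⊢ [ map _ᶜ xs ∷ʳ x ] →
        Γ ⊢ [ map (r all_) xs ∷ʳ (r all x) ᶜ ]

  structural : ∀ {xs ys} → toList xs ⊆ toList ys →
               Γ ⊢ [ xs ] → Γ ⊢ [ ys ]

  efq : ∀ {ys} xs → Γ ⊢ ⟨ ys ⟩ → Γ ⊢ [ ys ] → Γ ⊢ [ xs ]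

  raa : ∀ {ys} xs →
        (Γ ∪ ｛ [ xs ] ｝) ⊢ ⟨ ys ⟩ →
        (Γ ∪ ｛ [ xs ] ｝) ⊢ [ ys ] →
        Γ ⊢ ⟨ xs ⟩

{-# OPTIONS --safe #-}
module Submission where

-- Completeness is proved by a canonical model. Call a set of terms consistent
-- over Γ if no nonempty finite list ws of its elements has Γ ⊢ [ ws ]. The
-- points of the canonical model are the consistent sets m that contain x or x ᶜ
-- for every term x, and m is related to n by r when (r all x) ∈ m for some
-- x ∈ n. The truth lemma (truth⁺, truth⁻) says that m satisfies x exactly when
-- x ∈ m. Its only substantial case is that (r all x) is false at m whenever
-- (r all x) ∉ m: it needs a point n that contains x and contains y ᶜ for
-- every (r all y) ∈ m. These terms form a consistent set, because the rule rel
-- turns a refutation of y₁ ᶜ , … , yₖ ᶜ , x into a refutation of elements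
-- r all y₁ , … , r all yₖ , (r all x) ᶜ of m (avoiding-consistent).
--
-- Every nonempty consistent set extends to a point (Lindenbaum), completeness of
-- the extension coming from axiom and res. Hence the canonical model satisfies
-- [ ws ] if Γ ⊢ [ ws ] (𝓜⊨[]), and ⟨ ws ⟩ if not (𝓜⊨⟨⟩); when Γ does not
-- derive both ⟨ ys ⟩ and [ ys ] for any ys, it is a model of Γ. If Γ does not
-- derive [ xs ], then efq makes Γ consistent in this sense and the canonical
-- model refutes [ xs ]. If Γ does not derive ⟨ xs ⟩, then raa makes
-- Γ ∪ ｛ [ xs ] ｝ consistent, and its canonical model refutes ⟨ xs ⟩.
--
-- Nouns and verbs may form sets of any size, so the extension to a point needs a
-- maximality principle, here the lemma of Teichmüller and Tukey for families of
-- finite character (Tukey.maximal). Excluded middle decides arbitrary types, not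
-- only propositions, and so supplies a choice function; the lemma follows by
-- the Bourbaki-Witt argument: the closure of the empty set under "add one
-- admissible element" and unions is a chain (Tower), so its union is maximal.
-- Subsets are Bool-valued functions, which keeps power sets, and with them the
-- carrier of the canonical model, at the level of the terms; function
-- extensionality makes subsets with the same elements equal, as needed for
-- the choice of the added element to depend on the elements of the set only.

open import Axiom.ExcludedMiddle using (ExcludedMiddle)
open import Axiom.Extensionality.Propositional using (Extensionality; lower-extensionality)
open import Defs

open import Data.Bool.Base using (Bool; T)
open import Data.Bool.Properties using (⇔→≡; T-≡)
open import Data.Empty using (⊥-elim)
open import Data.List.Base as List using (List; []; _∷_; _++_; map)
import Data.List.Membership.Propositional as List
open import Data.List.Membership.Propositional.Properties using (∈-++⁺ˡ; ∈-++⁺ʳ)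
open import Data.List.NonEmpty.Base using (_∷_; toList; _∷ʳ_)
import Data.List.NonEmpty.Relation.Unary.All as NonEmpty
open import Data.List.Relation.Binary.Subset.Propositional using () renaming (_⊆_ to _⊆ₗ_)
open import Data.List.Relation.Binary.Subset.Propositional.Properties
  using (xs⊆x∷xs; ∷⁺ʳ; ∈-∷⁺ʳ)
open import Data.List.Relation.Unary.All as All using (All; []; _∷_)
import Data.List.Relation.Unary.All.Properties as All
open import Data.List.Relation.Unary.Any using (here; there)
open import Data.Product.Base using (∃; _×_; _,_; proj₁; proj₂)
open import Data.Sum.Base using (_⊎_; inj₁; inj₂)
open import Function.Bundles using (mk⇔)
open import Function.Base using (_∘_; id)
import Function.Properties.Equivalence as ⇔
open import Level using (Level; 0ℓ)
open import Relation.Binary.PropositionalEquality using (_≡_; refl; sym; cong; subst)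
open import Relation.Nullary.Decidable
  using (Dec; yes; no; isYes; toWitness; fromWitness; decidable-stable)
open import Relation.Nullary.Negation using (¬_)
open import Relation.Unary using (Pred; _∈_; _⊆_; _∪_; ｛_｝; Satisfiable)

private
  variable
    ℓ : Level
    A X : Set ℓ

-- Subsets and lists

-- Subsets by characteristic functions, so that Subset X stays in the universe
-- of X.
Subset : Set ℓ → Set ℓ
Subset X = X → Bool

-- The predicate of membership in a subset. A record, so that it lives at level ℓ
-- and s and x can be inferred from it.
record ⟪_⟫ {X : Set ℓ} (s : Subset X) (x : X) : Set ℓ where
  constructor member
  field holds : T (s x)

open ⟪_⟫

-- A list over B ∪ ｛ x ｝ is covered by x and a list over B.
split-off : {B : Pred A ℓ} {x : A} {zs : List A} → All (λ z → z ∈ B ⊎ x ≡ z) zs →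
            ∃ λ ys → All B ys × zs ⊆ₗ x ∷ ys
split-off []       = [] , [] , λ ()
split-off (inj₁ b ∷ ps) with split-off ps
... | ys , bs , zs⊆ = _ ∷ ys , b ∷ bs ,
  ∈-∷⁺ʳ (there (here refl)) (∷⁺ʳ _ (xs⊆x∷xs ys _) ∘ zs⊆)
split-off (inj₂ refl ∷ ps) with split-off ps
... | ys , bs , zs⊆ = ys , bs , ∈-∷⁺ʳ (here refl) zs⊆

toList-∷ʳ : (xs : List A) (x : A) → toList (xs ∷ʳ x) ≡ xs List.∷ʳ x
toList-∷ʳ []       x = refl
toList-∷ʳ (_ ∷ xs) x = refl

∷⊆∷ʳ : (xs : List A) (x : A) → x ∷ xs ⊆ₗ toList (xs ∷ʳ x)
∷⊆∷ʳ xs x rewrite toList-∷ʳ xs x = ∈-∷⁺ʳ (∈-++⁺ʳ xs (here refl)) ∈-++⁺ˡ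

module Classical {ℓ} (em : ExcludedMiddle ℓ) (ext : Extensionality ℓ ℓ) where

  -- An element of A or a proof that there is none, for any type A: together with
  -- stable, this is a choice function.
  dec : (A : Set ℓ) → Dec A
  dec A = em {A}

  stable : {A : Set ℓ} → ¬ ¬ A → A
  stable = decidable-stable em

  module _ {X : Set ℓ} where

    subset : Pred X ℓ → Subset X
    subset B x = isYes (dec (B x))

    subset⁺ : {B : Pred X ℓ} → B ⊆ ⟪ subset B ⟫
    subset⁺ b = member (fromWitness b)

    subset⁻ : {B : Pred X ℓ} → ⟪ subset B ⟫ ⊆ B
    subset⁻ (member h) = toWitness h

    ⊆-antisym : {s t : Subset X} → ⟪ s ⟫ ⊆ ⟪ t ⟫ → ⟪ t ⟫ ⊆ ⟪ s ⟫ → s ≡ t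
    ⊆-antisym s⊆t t⊆s = lower-extensionality 0ℓ ℓ ext λ x → ⇔→≡
      (⇔.trans (⇔.sym T-≡) (⇔.trans (mk⇔ (holds ∘ s⊆t ∘ member) (holds ∘ t⊆s ∘ member)) T-≡))

    ⋃ : Subset (Subset X) → Subset X
    ⋃ p = subset λ x → ∃ λ s → s ∈ ⟪ p ⟫ × x ∈ ⟪ s ⟫

    ⊆⋃ : {p : Subset (Subset X)} {s : Subset X} → s ∈ ⟪ p ⟫ → ⟪ s ⟫ ⊆ ⟪ ⋃ p ⟫
    ⊆⋃ s∈p x∈s = subset⁺ (_ , s∈p , x∈s)

  -- The tower of an inflationary map is a chain

  module Tower {X : Set ℓ} (f : Subset X → Subset X)
               (inflationary : ∀ s → ⟪ s ⟫ ⊆ ⟪ f s ⟫) where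

    -- The least class of subsets closed under f and under arbitrary unions. The
    -- empty set belongs to it as the union of the empty family.
    data Tower : Pred (Subset X) ℓ where
      step  : ∀ {s} → Tower s → Tower (f s)
      union : ∀ {p} → ⟪ p ⟫ ⊆ Tower → Tower (⋃ p)

    -- t is extreme if f does not lead from a proper subset of t in the tower to
    -- a set outside t.
    Extreme : Pred (Subset X) ℓ
    Extreme t = ∀ {u} → Tower u → ⟪ u ⟫ ⊆ ⟪ t ⟫ → ¬ ⟪ t ⟫ ⊆ ⟪ u ⟫ → ⟪ f u ⟫ ⊆ ⟪ t ⟫

    -- The second alternative is an equality, not just equality of elements: this
    -- is what allows replacing f u by f t.
    f-extreme : ∀ {t u} → Extreme t → Tower u → ⟪ u ⟫ ⊆ ⟪ t ⟫ → ⟪ f u ⟫ ⊆ ⟪ t ⟫ ⊎ u ≡ t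
    f-extreme {t} {u} ex τ u⊆t with dec (⟪ t ⟫ ⊆ ⟪ u ⟫)
    ... | yes t⊆u = inj₂ (⊆-antisym u⊆t t⊆u)
    ... | no  t⊈u = inj₁ (ex τ u⊆t t⊈u)

    -- Nothing in the tower lies strictly between an extreme t and f t, nor is
    -- incomparable with them.
    extreme-compare : ∀ {t u} → Extreme t → Tower u → ⟪ u ⟫ ⊆ ⟪ t ⟫ ⊎ ⟪ f t ⟫ ⊆ ⟪ u ⟫
    extreme-compare ex (step {v} τ) with extreme-compare ex τ
    ... | inj₂ ft⊆v = inj₂ (inflationary v ∘ ft⊆v)
    ... | inj₁ v⊆t with f-extreme ex τ v⊆t
    ...   | inj₁ fv⊆t = inj₁ fv⊆t
    ...   | inj₂ refl = inj₂ id
    extreme-compare {t} ex (union {p} τs) with dec (∃ λ q → q ∈ ⟪ p ⟫ × ⟪ f t ⟫ ⊆ ⟪ q ⟫)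
    ... | yes (q , q∈p , ft⊆q) = inj₂ (⊆⋃ q∈p ∘ ft⊆q)
    ... | no  none = inj₁ below
      where
      below : ⟪ ⋃ p ⟫ ⊆ ⟪ t ⟫
      below x∈ with subset⁻ x∈
      ... | q , q∈p , x∈q with extreme-compare ex (τs q∈p)
      ...   | inj₁ q⊆t  = q⊆t x∈q
      ...   | inj₂ ft⊆q = ⊥-elim (none (q , q∈p , ft⊆q))

    tower-extreme : ∀ {t} → Tower t → Extreme t
    tower-extreme (step {v} τ) υ u⊆fv fv⊈u with extreme-compare (tower-extreme τ) υ
    ... | inj₂ fv⊆u = ⊥-elim (fv⊈u fv⊆u)
    ... | inj₁ u⊆v with f-extreme (tower-extreme τ) υ u⊆v
    ...   | inj₁ fu⊆v = inflationary v ∘ fu⊆v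
    ...   | inj₂ refl = id
    tower-extreme (union {p} τs) {u} υ u⊆⋃p ⋃p⊈u
      with dec (∃ λ q → q ∈ ⟪ p ⟫ × ⟪ u ⟫ ⊆ ⟪ q ⟫)
    ... | no none = ⊥-elim (⋃p⊈u above)
      where
      above : ⟪ ⋃ p ⟫ ⊆ ⟪ u ⟫
      above x∈ with subset⁻ x∈
      ... | q , q∈p , x∈q with extreme-compare (tower-extreme (τs q∈p)) υ
      ...   | inj₁ u⊆q  = ⊥-elim (none (q , q∈p , u⊆q))
      ...   | inj₂ fq⊆u = fq⊆u (inflationary q x∈q)
    ... | yes (q , q∈p , u⊆q) with f-extreme (tower-extreme (τs q∈p)) υ u⊆q
    ...   | inj₁ fu⊆q = ⊆⋃ q∈p ∘ fu⊆q
    ...   | inj₂ refl with extreme-compare (tower-extreme (τs q∈p)) (union τs)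
    ...     | inj₁ ⋃p⊆q  = ⊥-elim (⋃p⊈u ⋃p⊆q)
    ...     | inj₂ fq⊆⋃p = fq⊆⋃p

    linear : ∀ {s t} → Tower s → Tower t → ⟪ s ⟫ ⊆ ⟪ t ⟫ ⊎ ⟪ t ⟫ ⊆ ⟪ s ⟫
    linear {t = t} σ τ with extreme-compare (tower-extreme τ) σ
    ... | inj₁ s⊆t  = inj₁ s⊆t
    ... | inj₂ ft⊆s = inj₂ (ft⊆s ∘ inflationary t)

    -- The union of the whole tower, which is its greatest element and therefore
    -- closed under f.
    top : Subset X
    top = ⋃ (subset Tower)

    top-tower : Tower top
    top-tower = union subset⁻

    top-closed : ⟪ f top ⟫ ⊆ ⟪ top ⟫
    top-closed = ⊆⋃ (subset⁺ (step top-tower))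

  -- The lemma of Teichmüller and Tukey

  -- F is the set of finite lists allowed inside a member of the family.
  module Tukey {X : Set ℓ} (F : Pred (List X) ℓ) (F-[] : F [])
               (F-⊆ : ∀ {xs ys} → xs ⊆ₗ ys → F ys → F xs) where

    -- The subsets all of whose finite lists are in F: a family of finite
    -- character.
    Family : Pred (Subset X) ℓ
    Family s = ∀ xs → All ⟪ s ⟫ xs → F xs

    -- x can be added to s within the family.
    Extends : Subset X → Pred X ℓ
    Extends s x = ∀ ys → All ⟪ s ⟫ ys → F (x ∷ ys)

    Fresh : Subset X → Pred X ℓ
    Fresh s x = ¬ x ∈ ⟪ s ⟫ × Extends s x

    -- Deciding the type of fresh elements yields one of them if there are any:
    -- this is the use of choice.
    enlarge : Subset X → Subset X
    enlarge s with dec (Satisfiable (Fresh s))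
    ... | yes (x , _) = subset (⟪ s ⟫ ∪ ｛ x ｝)
    ... | no  _       = s

    inflationary : ∀ s → ⟪ s ⟫ ⊆ ⟪ enlarge s ⟫
    inflationary s y∈s with dec (Satisfiable (Fresh s))
    ... | yes (x , _) = subset⁺ (inj₁ y∈s)
    ... | no  _       = y∈s

    open Tower enlarge inflationary

    enlarge-family : ∀ s → Family s → Family (enlarge s)
    enlarge-family s fam xs hs with dec (Satisfiable (Fresh s))
    ... | no  _ = fam xs hs
    ... | yes (x , _ , ok) with split-off (All.map subset⁻ hs)
    ...   | ys , ys∈s , xs⊆ = F-⊆ xs⊆ (ok ys ys∈s)

    -- As the tower is a chain, a nonempty finite part of a union lies in one of
    -- the sets united.
    within-member : ∀ {p xs} → ⟪ p ⟫ ⊆ Tower → All ⟪ ⋃ p ⟫ xs →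
                    xs ≡ [] ⊎ ∃ λ q → q ∈ ⟪ p ⟫ × All ⟪ q ⟫ xs
    within-member τs []         = inj₁ refl
    within-member τs (x∈ ∷ xs∈) with subset⁻ x∈ | within-member τs xs∈
    ... | q , q∈p , x∈q | inj₁ refl = inj₂ (q , q∈p , x∈q ∷ [])
    ... | q , q∈p , x∈q | inj₂ (r , r∈p , xs∈r) with linear (τs q∈p) (τs r∈p)
    ...   | inj₁ q⊆r = inj₂ (r , r∈p , q⊆r x∈q ∷ xs∈r)
    ...   | inj₂ r⊆q = inj₂ (q , q∈p , x∈q ∷ All.map r⊆q xs∈r)

    tower-family : ∀ {s} → Tower s → Family s
    tower-family (step τ)   = enlarge-family _ (tower-family τ)
    tower-family (union τs) xs hs with within-member τs hs
    ... | inj₁ refl               = F-[]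
    ... | inj₂ (q , q∈p , xs∈q) = tower-family (τs q∈p) xs xs∈q

    -- A set closed under enlarge has no fresh elements, since enlarge would
    -- otherwise have added one.
    closed-maximal : ∀ s → ⟪ enlarge s ⟫ ⊆ ⟪ s ⟫ → Extends s ⊆ ⟪ s ⟫
    closed-maximal s closed {x} x-ok with dec (Satisfiable (Fresh s))
    ... | yes (y , y∉s , _) = ⊥-elim (y∉s (closed (subset⁺ (inj₂ refl))))
    ... | no  none          = stable λ x∉s → none (x , x∉s , x-ok)

    -- A member of the family to which no further element can be added.
    maximal : ∃ λ s → Family s × Extends s ⊆ ⟪ s ⟫
    maximal = top , tower-family top-tower , closed-maximal top top-closed

  -- The canonical model

  module Canonical {P R : Set ℓ} (Γ : Theory P R) where

    -- No nonempty finite list of elements of B is provably of empty intersection.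
    Consistent : Pred (Pred (Term P R) ℓ) ℓ
    Consistent B = ∀ ws → All B (toList ws) → ¬ Γ ⊢ [ ws ]

    -- A point is a consistent set of terms that decides every term.
    record Point : Set ℓ where
      field
        carrier    : Subset (Term P R)
        consistent : Consistent ⟪ carrier ⟫
        complete   : ∀ x → x ∈ ⟪ carrier ⟫ ⊎ x ᶜ ∈ ⟪ carrier ⟫

    open Point

    _∋_ : Point → Term P R → Set ℓ
    m ∋ x = x ∈ ⟪ carrier m ⟫

    -- The element b ∈ B keeps the resolvent nonempty when ys and zs are empty.
    inconsistent-pair : {B : Pred (Term P R) ℓ} → Satisfiable B → Consistent B →
                        ∀ {x ys zs} → All B ys → All B zs →
                        Γ ⊢ [ x ∷ ys ] → ¬ Γ ⊢ [ x ᶜ ∷ zs ]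
    inconsistent-pair (b , b∈) con {x} {ys} {zs} ys∈ zs∈ d e =
      con (b ∷ ys ++ zs) (b∈ ∷ All.++⁺ ys∈ zs∈)
        (res (b ∷ ys ++ zs) refl (structural (∷⁺ʳ x (xs⊆x∷xs ys b)) d) e)

    -- The extension of a nonempty consistent set S to a point. The empty set is
    -- excluded because it is consistent even when Γ derives every [ ws ], in which
    -- case there are no points.
    module Lindenbaum {S : Pred (Term P R) ℓ} {z} (z∈S : z ∈ S) (S-con : Consistent S) where

      -- Consistency together with S: the tower starts from the empty set, and
      -- this choice of F makes every maximal member of the family contain S.
      F : Pred (List (Term P R)) ℓ
      F xs = Consistent (S ∪ (List._∈ xs))

      F-[] : F []
      F-[] ws hs = S-con ws (All.map (λ { (inj₁ s) → s }) hs)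

      F-⊆ : ∀ {xs ys} → xs ⊆ₗ ys → F ys → F xs
      F-⊆ xs⊆ys con ws hs = con ws (All.map (λ { (inj₁ s) → inj₁ s ; (inj₂ w) → inj₂ (xs⊆ys w) }) hs)

      open Tukey F F-[] F-⊆

      M : Subset (Term P R)
      M = proj₁ maximal

      M-family : Family M
      M-family = proj₁ (proj₂ maximal)

      S⊆M : S ⊆ ⟪ M ⟫
      S⊆M s = proj₂ (proj₂ maximal) λ ys ys∈M ws hs →
        M-family ys ys∈M ws (All.map (λ { (inj₁ t) → inj₁ t
                                        ; (inj₂ (here refl)) → inj₁ s
                                        ; (inj₂ (there w)) → inj₂ w }) hs)

      M-con : Consistent ⟪ M ⟫
      M-con ws ws∈M = M-family (toList ws) ws∈M ws (All.tabulate inj₂)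

      -- A term outside M is inconsistent with finitely many elements of M.
      refute : ∀ {x} → ¬ x ∈ ⟪ M ⟫ → ∃ λ ys → All ⟪ M ⟫ ys × Γ ⊢ [ x ∷ ys ]
      refute {x} x∉M = stable λ none → x∉M (proj₂ (proj₂ maximal) λ ys ys∈M ws hs d →
        let zs , zs∈M , ws⊆ = split-off (All.map (locate ys∈M) hs)
        in  none (zs , zs∈M , structural ws⊆ d))
        where
        locate : ∀ {ys w} → All ⟪ M ⟫ ys → (S ∪ (List._∈ x ∷ ys)) w → w ∈ ⟪ M ⟫ ⊎ x ≡ w
        locate ys∈M (inj₁ s)            = inj₁ (S⊆M s)
        locate ys∈M (inj₂ (here w≡x))   = inj₂ (sym w≡x)
        locate ys∈M (inj₂ (there w∈ys)) = inj₁ (All.lookup ys∈M w∈ys)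

      M-complete : ∀ x → x ∈ ⟪ M ⟫ ⊎ x ᶜ ∈ ⟪ M ⟫
      M-complete x with dec (x ∈ ⟪ M ⟫) | dec (x ᶜ ∈ ⟪ M ⟫)
      ... | yes x∈M | _        = inj₁ x∈M
      ... | no  _   | yes xᶜ∈M = inj₂ xᶜ∈M
      ... | no  x∉M | no  xᶜ∉M with refute x∉M | refute xᶜ∉M
      ...   | ys , ys∈M , d | zs , zs∈M , e =
        ⊥-elim (inconsistent-pair (z , S⊆M z∈S) M-con ys∈M zs∈M d e)

      point : Point
      point = record { carrier = M ; consistent = M-con ; complete = M-complete }

    open Lindenbaum using (point; S⊆M)

    ∋-ᶜ⁻ : ∀ m {x} → m ∋ (x ᶜ) → ¬ m ∋ x
    ∋-ᶜ⁻ m {x} xᶜ∈m x∈m = consistent m _ (x∈m ∷ xᶜ∈m ∷ []) (axiom x)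

    ∋-ᶜ⁺ : ∀ m {x} → ¬ m ∋ x → m ∋ (x ᶜ)
    ∋-ᶜ⁺ m {x} x∉m with complete m x
    ... | inj₁ x∈m  = ⊥-elim (x∉m x∈m)
    ... | inj₂ xᶜ∈m = xᶜ∈m

    -- m is related to n by r if some x ∈ n has (r all x) ∈ m:
    -- the least relation that makes all (r all x) in m true at m.
    𝓜 : Model P R
    𝓜 = record
      { Carrier = Point
      ; nounᴹ   = λ p m → m ∋ noun p
      ; verbᴹ   = λ r m n → ∃ λ x → m ∋ (r all x) × n ∋ x
      }

    open Model 𝓜 using (⟦_⟧)

    -- The terms required of a point n that contains x and is not related to m
    -- by r.
    Avoiding : Point → R → Term P R → Pred (Term P R) ℓ
    Avoiding m r x = (λ t → ∃ λ y → t ≡ y ᶜ × m ∋ (r all y)) ∪ ｛ x ｝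

    -- A list of complements of elements of Q is the image of a list over Q.
    complemented : ∀ {Q : Pred (Term P R) ℓ} {ts} → All (λ t → ∃ λ y → t ≡ y ᶜ × y ∈ Q) ts →
                   ∃ λ ys → All Q ys × ts ≡ map _ᶜ ys
    complemented [] = [] , [] , refl
    complemented ((y , refl , q) ∷ hs) =
      let ys , qs , ts≡ = complemented hs
      in  y ∷ ys , q ∷ qs , cong (y ᶜ ∷_) ts≡

    avoiding-consistent : ∀ m r x → ¬ m ∋ (r all x) → Consistent (Avoiding m r x)
    avoiding-consistent m r x rx∉m ws hs d with split-off hs
    ... | ts , ts∈ , ws⊆ with complemented ts∈
    ...   | ys , ys∈ , refl =
      consistent m _
        (subst (All _) (sym (toList-∷ʳ (map (r all_) ys) _))
          (All.∷ʳ⁺ (All.map⁺ ys∈) (∋-ᶜ⁺ m rx∉m)))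
        (rel r ys x (structural (∷⊆∷ʳ (map _ᶜ ys) x ∘ ws⊆) d))

    -- The truth lemma, by simultaneous induction on the term; each direction
    -- uses the other one under a complement and for the argument of a verb.
    truth⁺ : ∀ x {m} → m ∋ x → m ∈ ⟦ x ⟧
    truth⁻ : ∀ x {m} → m ∈ ⟦ x ⟧ → m ∋ x

    truth⁺ (noun p)  x∈m           = x∈m
    truth⁺ (r all x) rx∈m n n∈⟦x⟧ = x , rx∈m , truth⁻ x n∈⟦x⟧
    truth⁺ (x ᶜ) {m} xᶜ∈m m∈⟦x⟧  = ∋-ᶜ⁻ m xᶜ∈m (truth⁻ x m∈⟦x⟧)

    truth⁻ (noun p)  m∈ = m∈
    truth⁻ (x ᶜ) {m} m∉ = ∋-ᶜ⁺ m (m∉ ∘ truth⁺ x)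
    truth⁻ (r all x) {m} m∈ = stable λ rx∉m →
      -- n is a counterexample to r all x at m: it contains x, and it contains y ᶜ
      -- for every y that could witness verbᴹ r m n.
      let con = avoiding-consistent m r x rx∉m
          n   = point (inj₂ refl) con
          n⊇  = S⊆M (inj₂ refl) con
          y , ry∈m , y∈n = m∈ n (truth⁺ x (n⊇ (inj₂ refl)))
      in  ∋-ᶜ⁻ n (n⊇ (inj₁ (y , refl , ry∈m))) y∈n

    𝓜⊨[] : ∀ {ws} → Γ ⊢ [ ws ] → 𝓜 ⊨ᴹ [ ws ]
    𝓜⊨[] d m (x NonEmpty.∷ xs) = consistent m _ (truth⁻ _ x ∷ All.map (truth⁻ _) xs) d

    𝓜⊨⟨⟩ : ∀ {ws} → ¬ Γ ⊢ [ ws ] → 𝓜 ⊨ᴹ ⟨ ws ⟩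
    𝓜⊨⟨⟩ {w ∷ ws} ⊬ws = point (here refl) con ,
        truth⁺ w (⊇ (here refl)) NonEmpty.∷ All.tabulate (λ x∈ → truth⁺ _ (⊇ (there x∈)))
      where
      con : Consistent (List._∈ w ∷ ws)
      con vs hs d = ⊬ws (structural (All.lookup hs) d)
      ⊇ : ∀ {x} → x List.∈ w ∷ ws → point (here refl) con ∋ x
      ⊇ = S⊆M (here refl) con

    𝓜⊨Γ : (∀ {ys} → Γ ⊢ ⟨ ys ⟩ → ¬ Γ ⊢ [ ys ]) → ∀ ψ → ψ ∈ Γ → 𝓜 ⊨ᴹ ψ
    𝓜⊨Γ con [ ws ] ψ∈Γ = 𝓜⊨[] (assumption ψ∈Γ)
    𝓜⊨Γ con ⟨ ws ⟩ ψ∈Γ = 𝓜⊨⟨⟩ (con (assumption ψ∈Γ))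

theorem4p11 : ∀ {ℓ} → ExcludedMiddle ℓ → Extensionality ℓ ℓ → {P R : Set ℓ} (Γ : Theory P R) (φ : Sentence P R) → Γ ⊨ φ → Γ ⊢ φ
theorem4p11 em ext Γ [ xs ] Γ⊨φ = stable λ ⊬xs →
  let open Canonical Γ
      m , m∈ = 𝓜⊨⟨⟩ ⊬xs
  in  Γ⊨φ 𝓜 (𝓜⊨Γ λ d e → ⊬xs (efq xs d e)) m m∈
  where open Classical em ext
theorem4p11 em ext Γ ⟨ xs ⟩ Γ⊨φ = stable λ ⊬xs →
  let open Canonical (Γ ∪ ｛ [ xs ] ｝)
      m , m∈ = Γ⊨φ 𝓜 (λ ψ ψ∈Γ → 𝓜⊨Γ (λ d e → ⊬xs (raa xs d e)) ψ (inj₁ ψ∈Γ))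
  in  𝓜⊨[] (assumption (inj₂ refl)) m m∈
  where open Classical em ext
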